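{- Let $p\ge2$ be an integer, $r\in\{0,\dots,p-1\}$, and let $f:\mathbb{Z}_p\to\mathbb{Z}_p$ be a function such that $f(r+p\mathbb{Z}_p)\subseteq p\mathbb{Z}_p$ and $f$ is $(p,r)$-suitable. Then $f$ has a unique root in $r+p\mathbb{Z}_p$.
   Context: $p\ge2$ is an integer, not necessarily prime. $\mathbb{Z}_p=\varprojlim \mathbb{Z}/p^k\mathbb{Z}$; every $a\in\mathbb{Z}_p$ is uniquely $a=\sum_{i\ge0}a_ip^i$ with $a_i\in\{0,\dots,p-1\}$, and $a\,\%\,p:=a_0$. A function $f:\mathbb{Z}_p\to\mathbb{Z}_p$ is $(p,r)$-suitable if for all integers $k\ge0$ and all $m,n\in r+p\mathbb{Z}_p$: $m\equiv n\pmod{p^k}$ if and only if $f(m)-(f(m)\%p)\equiv f(n)-(f(n)\%p)\pmod{p^k}$. -}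

module Defs where

open import Algebra.Bundles using (CommutativeRing)
open import Data.Fin.Base using (Fin; toℕ; fromℕ<)
open import Data.Fin.Properties using (toℕ-fromℕ<; toℕ-injective; toℕ<n)
open import Data.Integer.Base as ℤ using (ℤ; +_; _%ℕ_; _/ℕ_)
open import Data.Integer.Divisibility.Signed as ℤ using (divides)
import Data.Integer.DivMod as ℤ
import Data.Integer.Properties as ℤ
open import Data.Integer.Tactic.RingSolver using (solve-∀)
open import Data.Nat.Base as ℕ
  using (ℕ; zero; suc; _^_; _/_; _%_; NonZero; NonTrivial; nonTrivial⇒nonZero)
import Data.Nat.Divisibility as ℕ
import Data.Nat.DivMod as ℕ
import Data.Nat.Properties as ℕ
open import Data.Product using (∃; _,_)
open import Function.Bundles using (Func; _⟨$⟩_; _⇔_)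
open import Level using (0ℓ)
open import Relation.Binary.PropositionalEquality
  using (_≡_; refl; sym; trans; cong; cong₂; subst; module ≡-Reasoning)
open import Relation.Nullary using (contradiction)
open import Relation.Unary using (Pred; _∈_)

infix 4 _≡_[ℤ/_]

record _≡_[ℤ/_] (a b : ℤ) (n : ℕ) : Set where
  constructor cong-mod
  field
    n∣a-b : + n ℤ.∣ a ℤ.- b

module _ {n : ℕ} where

  mod-reflexive : ∀ {a b} → a ≡ b → a ≡ b [ℤ/ n ]
  mod-reflexive {a} refl = cong-mod (divides (+ 0) (ℤ.+-inverseʳ a))

  mod-sym : ∀ {a b} → a ≡ b [ℤ/ n ] → b ≡ a [ℤ/ n ]
  mod-sym {a} {b} (cong-mod e) =
    cong-mod (subst (+ n ℤ.∣_) (eq a b) (ℤ.∣m⇒∣-m e))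
    where
    eq : ∀ a b → ℤ.- (a ℤ.- b) ≡ b ℤ.- a
    eq = solve-∀

  mod-trans : ∀ {a b c} → a ≡ b [ℤ/ n ] → b ≡ c [ℤ/ n ] → a ≡ c [ℤ/ n ]
  mod-trans {a} {b} {c} (cong-mod e) (cong-mod f) =
    cong-mod (subst (+ n ℤ.∣_) (eq a b c) (ℤ.∣m∣n⇒∣m+n e f))
    where
    eq : ∀ a b c → (a ℤ.- b) ℤ.+ (b ℤ.- c) ≡ a ℤ.- c
    eq = solve-∀

  mod-+-cong : ∀ {a b c d} → a ≡ b [ℤ/ n ] → c ≡ d [ℤ/ n ] →
               a ℤ.+ c ≡ b ℤ.+ d [ℤ/ n ]
  mod-+-cong {a} {b} {c} {d} (cong-mod e) (cong-mod f) =
    cong-mod (subst (+ n ℤ.∣_) (eq a b c d) (ℤ.∣m∣n⇒∣m+n e f))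
    where
    eq : ∀ a b c d → (a ℤ.- b) ℤ.+ (c ℤ.- d) ≡ (a ℤ.+ c) ℤ.- (b ℤ.+ d)
    eq = solve-∀

  mod-*-cong : ∀ {a b c d} → a ≡ b [ℤ/ n ] → c ≡ d [ℤ/ n ] →
               a ℤ.* c ≡ b ℤ.* d [ℤ/ n ]
  mod-*-cong {a} {b} {c} {d} (cong-mod e) (cong-mod f) =
    cong-mod (subst (+ n ℤ.∣_) (eq a b c d)
      (ℤ.∣m∣n⇒∣m+n (ℤ.∣m⇒∣m*n c e) (ℤ.∣n⇒∣m*n b f)))
    where
    eq : ∀ a b c d →
         (a ℤ.- b) ℤ.* c ℤ.+ b ℤ.* (c ℤ.- d) ≡ (a ℤ.* c) ℤ.- (b ℤ.* d)
    eq = solve-∀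

  mod-neg-cong : ∀ {a b} → a ≡ b [ℤ/ n ] → ℤ.- a ≡ ℤ.- b [ℤ/ n ]
  mod-neg-cong {a} {b} (cong-mod e) =
    cong-mod (subst (+ n ℤ.∣_) (eq a b) (ℤ.∣m⇒∣-m e))
    where
    eq : ∀ a b → ℤ.- (a ℤ.- b) ≡ (ℤ.- a) ℤ.- (ℤ.- b)
    eq = solve-∀

  %ℕ-mod : ∀ a .{{_ : NonZero n}} → + (a %ℕ n) ≡ a [ℤ/ n ]
  %ℕ-mod a = mod-sym (cong-mod (divides (a /ℕ n)
    (trans (cong (ℤ._- + (a %ℕ n)) (ℤ.a≡a%ℕn+[a/ℕn]*n a n))
           (eq (+ (a %ℕ n)) (a /ℕ n ℤ.* + n)))))
    where
    eq : ∀ x y → (x ℤ.+ y) ℤ.- x ≡ y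
    eq = solve-∀

  mod-< : ∀ {u v} → u ℕ.< n → v ℕ.< n → + u ≡ + v [ℤ/ n ] → u ≡ v
  mod-< {u} {v} u<n v<n (cong-mod e)
    with ℤ.∣ + u ℤ.- + v ∣ in eq | ℤ.∣⇒∣ᵤ e
  ... | zero  | _ = ℤ.+-injective
                      (ℤ.i-j≡0⇒i≡j (+ u) (+ v) (ℤ.∣i∣≡0⇒i≡0 eq))
  ... | suc d | n∣ = contradiction (ℕ.∣⇒≤ n∣) (ℕ.<⇒≱ (subst (ℕ._< n)
          (trans (cong ℤ.∣_∣ (sym (ℤ.m-n≡m⊖n u v))) eq)
          (ℕ.≤-<-trans (ℤ.∣m⊝n∣≤m⊔n u v) (ℕ.⊔-pres-<m u<n v<n))))

mod-coarsen : ∀ {m n a b} → m ℕ.∣ n → a ≡ b [ℤ/ n ] → a ≡ b [ℤ/ m ]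
mod-coarsen m∣n (cong-mod e) = cong-mod (ℤ.∣-trans (ℤ.∣ᵤ⇒∣ m∣n) e)

module Padic (p : ℕ) .{{_ : NonTrivial p}} where

  instance
    p≢0 : NonZero p
    p≢0 = nonTrivial⇒nonZero p

  p^≢0 : ∀ k → NonZero (p ^ k)
  p^≢0 k = ℕ.m^n≢0 p k

  -- The inverse limit of the ℤ/pᵏℤ. A class in ℤ/pᵏℤ is given by an arbitrary
  -- integer representative, and equality is congruence at every level.
  record ℤₚ : Set where
    constructor mkℤₚ
    field
      residue    : ℕ → ℤ
      compatible : ∀ k → residue (suc k) ≡ residue k [ℤ/ p ^ k ]

  open ℤₚ public

  infix 4 _≈ₚ_

  record _≈ₚ_ (x y : ℤₚ) : Set where
    constructor mk≈
    field
      at : ∀ k → residue x k ≡ residue y k [ℤ/ p ^ k ]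

  open _≈ₚ_ public

  fromℤ : ℤ → ℤₚ
  fromℤ a = mkℤₚ (λ _ → a) (λ _ → mod-reflexive refl)

  fromℕ : ℕ → ℤₚ
  fromℕ n = fromℤ (+ n)

  ℤₚ-commutativeRing : CommutativeRing 0ℓ 0ℓ
  ℤₚ-commutativeRing = record
    { Carrier = ℤₚ
    ; _≈_     = _≈ₚ_
    ; _+_     = λ x y → mkℤₚ (λ k → residue x k ℤ.+ residue y k)
                             (λ k → mod-+-cong (compatible x k) (compatible y k))
    ; _*_     = λ x y → mkℤₚ (λ k → residue x k ℤ.* residue y k)
                             (λ k → mod-*-cong (compatible x k) (compatible y k))
    ; -_      = λ x → mkℤₚ (λ k → ℤ.- residue x k)
                           (λ k → mod-neg-cong (compatible x k))
    ; 0#      = fromℕ 0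
    ; 1#      = fromℕ 1
    ; isCommutativeRing = record
      { isRing = record
        { +-isAbelianGroup = record
          { isGroup = record
            { isMonoid = record
              { isSemigroup = record
                { isMagma = record
                  { isEquivalence = record
                    { refl  = law λ _ → refl
                    ; sym   = λ e → mk≈ λ k → mod-sym (at e k)
                    ; trans = λ e f → mk≈ λ k → mod-trans (at e k) (at f k)
                    }
                  ; ∙-cong = λ e f → mk≈ λ k → mod-+-cong (at e k) (at f k)
                  }
                ; assoc = λ x y z → law λ k →
                    ℤ.+-assoc (residue x k) (residue y k) (residue z k)
                }
              ; identity = (λ x → law λ k → ℤ.+-identityˡ (residue x k))
                         , (λ x → law λ k → ℤ.+-identityʳ (residue x k))
              }
            ; inverse = (λ x → law λ k → ℤ.+-inverseˡ (residue x k))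
                      , (λ x → law λ k → ℤ.+-inverseʳ (residue x k))
            ; ⁻¹-cong = λ e → mk≈ λ k → mod-neg-cong (at e k)
            }
          ; comm = λ x y → law λ k → ℤ.+-comm (residue x k) (residue y k)
          }
        ; *-cong     = λ e f → mk≈ λ k → mod-*-cong (at e k) (at f k)
        ; *-assoc    = λ x y z → law λ k →
                         ℤ.*-assoc (residue x k) (residue y k) (residue z k)
        ; *-identity = (λ x → law λ k → ℤ.*-identityˡ (residue x k))
                     , (λ x → law λ k → ℤ.*-identityʳ (residue x k))
        ; distrib    = (λ x y z → law λ k →
                         ℤ.*-distribˡ-+ (residue x k) (residue y k) (residue z k))
                     , (λ x y z → law λ k →
                         ℤ.*-distribʳ-+ (residue x k) (residue y k) (residue z k))
        }
      ; *-comm = λ x y → law λ k → ℤ.*-comm (residue x k) (residue y k)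
      }
    }
    where
    law : ∀ {x y} → (∀ k → residue x k ≡ residue y k) → x ≈ₚ y
    law e = mk≈ λ k → mod-reflexive (e k)

  open CommutativeRing ℤₚ-commutativeRing public
    using (_≈_; _+_; _*_; _-_; 0#; 1#; semiring)
    renaming (refl to ≈-refl; sym to ≈-sym; trans to ≈-trans; setoid to ℤₚ-setoid)
  open import Algebra.Properties.Semiring.Divisibility semiring public
    using (_∣_)

  infix 4 _≡_[modp^_]

  _≡_[modp^_] : ℤₚ → ℤₚ → ℕ → Set
  x ≡ y [modp^ k ] = fromℕ (p ^ k) ∣ x - y

  -- The i-th base-p digit of the representative of x in {0, …, pⁱ⁺¹ - 1};
  -- the lemmas up to `digit-cong` show that these are the digits of the unique
  -- expansion x = Σᵢ xᵢ pⁱ.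
  digit : ℤₚ → ℕ → Fin p
  digit x i = fromℕ< (ℕ.m<n*o⇒m/o<n {n = p} (ℤ.n%ℕd<d (residue x (suc i)) (p ^ suc i)))
    where instance
    _ = p^≢0 i
    _ = p^≢0 (suc i)

  partialSum : (ℕ → Fin p) → ℕ → ℕ
  partialSum d zero    = 0
  partialSum d (suc k) = partialSum d k ℕ.+ toℕ (d k) ℕ.* p ^ k

  fromDigits : (ℕ → Fin p) → ℤₚ
  fromDigits d = mkℤₚ (λ k → + partialSum d k) λ k → cong-mod (divides (+ toℕ (d k)) (begin
    + (partialSum d k ℕ.+ toℕ (d k) ℕ.* p ^ k) ℤ.- + partialSum d k
      ≡⟨ cong (ℤ._- + partialSum d k) (ℤ.pos-+ (partialSum d k) _) ⟩
    (+ partialSum d k ℤ.+ + (toℕ (d k) ℕ.* p ^ k)) ℤ.- + partialSum d k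
      ≡⟨ eq (+ partialSum d k) _ ⟩
    + (toℕ (d k) ℕ.* p ^ k)
      ≡⟨ ℤ.pos-* (toℕ (d k)) (p ^ k) ⟩
    + toℕ (d k) ℤ.* + (p ^ k) ∎))
    where
    open ≡-Reasoning
    eq : ∀ x y → (x ℤ.+ y) ℤ.- x ≡ y
    eq = solve-∀

  partialSum-< : ∀ d k → partialSum d k ℕ.< p ^ k
  partialSum-< d zero    = ℕ.s≤s ℕ.z≤n
  partialSum-< d (suc k) = begin-strict
    partialSum d k ℕ.+ toℕ (d k) ℕ.* p ^ k <⟨ ℕ.+-monoˡ-< _ (partialSum-< d k) ⟩
    suc (toℕ (d k)) ℕ.* p ^ k              ≤⟨ ℕ.*-monoˡ-≤ (p ^ k) (toℕ<n (d k)) ⟩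
    p ℕ.* p ^ k                            ∎
    where open ℕ.≤-Reasoning

  partialSum-digit : ∀ x k → let instance _ = p^≢0 k in
                     partialSum (digit x) k ≡ residue x k %ℕ p ^ k
  partialSum-digit x zero    = sym (ℕ.n<1⇒n≡0 (ℤ.n%ℕd<d (residue x 0) 1))
  partialSum-digit x (suc k) = begin
    partialSum (digit x) k ℕ.+ toℕ (digit x k) ℕ.* p ^ k
      ≡⟨ cong₂ (λ u v → u ℕ.+ v ℕ.* p ^ k)
           (partialSum-digit x k) (toℕ-fromℕ< {m = N / p ^ k} _) ⟩
    residue x k %ℕ p ^ k ℕ.+ (N / p ^ k) ℕ.* p ^ k
      ≡⟨ cong (ℕ._+ (N / p ^ k) ℕ.* p ^ k)
           (mod-< (ℤ.n%ℕd<d (residue x k) (p ^ k)) (ℕ.m%n<n N (p ^ k)) step) ⟩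
    N % p ^ k ℕ.+ (N / p ^ k) ℕ.* p ^ k
      ≡⟨ ℕ.m≡m%n+[m/n]*n N (p ^ k) ⟨
    N ∎
    where
    open ≡-Reasoning
    instance
      _ = p^≢0 k
      _ = p^≢0 (suc k)
    N = residue x (suc k) %ℕ p ^ suc k
    step : + (residue x k %ℕ p ^ k) ≡ + (N % p ^ k) [ℤ/ p ^ k ]
    step = mod-trans (%ℕ-mod (residue x k)) (mod-trans (mod-sym (compatible x k))
             (mod-sym (mod-trans (%ℕ-mod (+ N))
               (mod-coarsen (ℕ.n∣m*n p) (%ℕ-mod (residue x (suc k)))))))

  fromDigits-digit : ∀ x → fromDigits (digit x) ≈ x
  fromDigits-digit x = mk≈ λ k → let instance _ = p^≢0 k in
    mod-trans (mod-reflexive (cong +_ (partialSum-digit x k))) (%ℕ-mod (residue x k))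

  fromDigits-injective : ∀ d e → fromDigits d ≈ fromDigits e → ∀ i → d i ≡ e i
  fromDigits-injective d e eq i = toℕ-injective
    (ℕ.*-cancelʳ-≡ _ _ (p ^ i) {{p^≢0 i}} (ℕ.+-cancelˡ-≡ (partialSum d i) _ _
      (trans (sums (suc i)) (cong (ℕ._+ _) (sym (sums i))))))
    where
    sums : ∀ k → partialSum d k ≡ partialSum e k
    sums k = mod-< (partialSum-< d k) (partialSum-< e k) (at eq k)

  digit-cong : ∀ {x y} → x ≈ y → ∀ i → digit x i ≡ digit y i
  digit-cong {x} {y} e = fromDigits-injective (digit x) (digit y)
    (≈-trans (fromDigits-digit x) (≈-trans e (≈-sym (fromDigits-digit y))))

  infixl 7 _%p

  _%p : ℤₚ → ℕ
  x %p = toℕ (digit x 0)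

  pℤₚ : Pred ℤₚ 0ℓ
  pℤₚ x = fromℕ p ∣ x

  _+pℤₚ : Fin p → Pred ℤₚ 0ℓ
  (r +pℤₚ) x = ∃ λ z → x ≈ fromℕ (toℕ r) + fromℕ p * z

  -- A function ℤₚ → ℤₚ has to respect _≈_, hence `Func`.
  Suitable : Fin p → Func ℤₚ-setoid ℤₚ-setoid → Set
  Suitable r f = ∀ k {m n} → m ∈ r +pℤₚ → n ∈ r +pℤₚ →
    m ≡ n [modp^ k ] ⇔
    (f ⟨$⟩ m) - fromℕ ((f ⟨$⟩ m) %p) ≡ (f ⟨$⟩ n) - fromℕ ((f ⟨$⟩ n) %p) [modp^ k ]

{-# OPTIONS --safe #-}

-- Write f (r + p z) = p (g z). Suitability says exactly that g preserves and
-- reflects congruence modulo every pᵏ. Hence g induces an injection of the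
-- finite set ℤ/pᵏℤ into itself, which is surjective by the pigeonhole
-- principle, so g has a root modulo pᵏ; reflection of congruences makes these
-- approximate roots compatible, and their limit z gives the root r + p z.

module Submission where

open import Defs
open import Algebra.Definitions.RawMagma using (_,_)
open import Data.Fin.Base using (Fin; toℕ; fromℕ<; punchOut)
open import Data.Fin.Properties
  using (any?; _≟_; <⇒notInjective; punchOut-injective; toℕ-injective; toℕ<n;
         fromℕ<-injective)
open import Data.Integer.Base as ℤ using (ℤ; +_; _%ℕ_)
open import Data.Integer.Divisibility.Signed as ℤ using (divides)
import Data.Integer.DivMod as ℤ
import Data.Integer.Properties as ℤ
open import Data.Integer.Tactic.RingSolver using (solve-∀)
open import Data.Nat.Base as ℕ using (ℕ; suc; _^_; NonTrivial; NonZero)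
import Data.Nat.Divisibility as ℕ
import Data.Nat.Properties as ℕ
open import Data.Product using (_×_; ∃; ∃!; _,_; proj₁; proj₂)
open import Function.Base using (_∘_)
open import Function.Bundles using (Func; _⟨$⟩_; _⇔_; mk⇔; Equivalence)
open import Function.Definitions using (Injective; StrictlySurjective)
open import Relation.Binary.PropositionalEquality
  using (_≡_; refl; sym; trans; cong; cong₂; subst; subst₂)
open import Relation.Nullary using (yes; no; contradiction)
open import Relation.Unary using (_∈_)

-- Pigeonhole principle

injective⇒strictlySurjective : ∀ {n} {f : Fin n → Fin n} →
  Injective _≡_ _≡_ f → StrictlySurjective _≡_ f
injective⇒strictlySurjective {suc n} {f} inj y with any? (λ x → f x ≟ y)
... | yes hit  = hit
-- A missed `y` can be punched out of the codomain, leaving an injection from `Fin (suc n)` into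
-- `Fin n`.
... | no  miss = contradiction
  (λ {i} {j} → inj ∘ punchOut-injective (y≢f i) (y≢f j))
  (<⇒notInjective (ℕ.n<1+n n))
  where
  y≢f : ∀ x → y ≡ f x → _
  y≢f x y≡fx = miss (x , sym y≡fx)

-- Congruences between integers

^-monoʳ-∣ : ∀ m {j k} → j ℕ.≤ k → m ^ j ℕ.∣ m ^ k
^-monoʳ-∣ m {j} j≤k with o , refl ← ℕ.m≤n⇒∃[o]m+o≡n j≤k =
  subst (m ^ j ℕ.∣_) (sym (ℕ.^-distribˡ-+-* m j o)) (ℕ.m∣m*n (m ^ o))

module _ {n : ℕ} where

  difference-mod : ∀ {a b} → a ℤ.- b ≡ + 0 [ℤ/ n ] → a ≡ b [ℤ/ n ]
  difference-mod (cong-mod e) = cong-mod (subst (+ n ℤ.∣_) (ℤ.+-identityʳ _) e)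

  mod-difference : ∀ {a b} → a ≡ b [ℤ/ n ] → a ℤ.- b ≡ + 0 [ℤ/ n ]
  mod-difference (cong-mod e) =
    cong-mod (subst (+ n ℤ.∣_) (sym (ℤ.+-identityʳ _)) e)

  multiple-mod : ∀ a → a ℤ.* + n ≡ + 0 [ℤ/ n ]
  multiple-mod a = cong-mod (divides a (ℤ.+-identityʳ _))

  mod-*-scaleˡ : ∀ c a b → a ≡ b [ℤ/ n ] → + c ℤ.* a ≡ + c ℤ.* b [ℤ/ c ℕ.* n ]
  mod-*-scaleˡ c a b (cong-mod e) = cong-mod
    (subst₂ ℤ._∣_ (sym (ℤ.pos-* c n)) (eq (+ c) a b) (ℤ.*-monoʳ-∣ (+ c) e))
    where
    eq : ∀ c a b → c ℤ.* (a ℤ.- b) ≡ c ℤ.* a ℤ.- c ℤ.* b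
    eq = solve-∀

  -- The modulus loses the factor `c` too, so `c` may share factors with `n`.
  mod-*-cancelˡ : ∀ c .{{_ : NonZero c}} a b →
                  + c ℤ.* a ≡ + c ℤ.* b [ℤ/ c ℕ.* n ] → a ≡ b [ℤ/ n ]
  mod-*-cancelˡ c@(suc _) a b (cong-mod e) = cong-mod
    (ℤ.*-cancelˡ-∣ (+ c) (subst₂ ℤ._∣_ (ℤ.pos-* c n) (eq (+ c) a b) e))
    where
    eq : ∀ c a b → c ℤ.* a ℤ.- c ℤ.* b ≡ c ℤ.* (a ℤ.- b)
    eq = solve-∀

  mod-+-cancelˡ : ∀ c a b → c ℤ.+ a ≡ c ℤ.+ b [ℤ/ n ] → a ≡ b [ℤ/ n ]
  mod-+-cancelˡ c a b (cong-mod e) = cong-mod (subst (+ n ℤ.∣_) (eq c a b) e)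
    where
    eq : ∀ c a b → (c ℤ.+ a) ℤ.- (c ℤ.+ b) ≡ a ℤ.- b
    eq = solve-∀

-- Congruence in the p-adic integers, level by level

module _ (p : ℕ) .{{_ : NonTrivial p}} where
  open Padic p
  open Equivalence using (to; from)

  infix 4 _≡_[level_]

  -- A form of `_≡_[modp^_]` that compares a single pair of integers instead of asking for a p-adic
  -- quotient; `∣⇒level` and `level⇒∣` translate between the two.
  _≡_[level_] : ℤₚ → ℤₚ → ℕ → Set
  x ≡ y [level k ] = residue x k ≡ residue y k [ℤ/ p ^ k ]

  residue-≤ : ∀ x {j k} → j ℕ.≤ k → residue x k ≡ residue x j [ℤ/ p ^ j ]
  residue-≤ x {j} = go ∘ ℕ.≤⇒≤′
    where
    go : ∀ {k} → j ℕ.≤′ k → residue x k ≡ residue x j [ℤ/ p ^ j ]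
    go ℕ.≤′-refl           = mod-reflexive refl
    go (ℕ.≤′-step {k} j≤k) = mod-trans
      (mod-coarsen (^-monoʳ-∣ p (ℕ.≤′⇒≤ j≤k)) (compatible x k)) (go j≤k)

  ∣⇒level : ∀ k z → fromℕ (p ^ k) ∣ z → residue z k ≡ + 0 [ℤ/ p ^ k ]
  ∣⇒level k z (q , e) = mod-trans (mod-sym (at e k)) (multiple-mod (residue q k))

  level⇒∣ : ∀ k z → residue z k ≡ + 0 [ℤ/ p ^ k ] → fromℕ (p ^ k) ∣ z
  -- Division by `p ^ k` costs k levels of precision, so residue j of the quotient is read off from
  -- `z` at level k + j.
  level⇒∣ k z z≡0 = mkℤₚ quotient quotient-compatible , mk≈ λ j →
    mod-trans (mod-reflexive (sym (factor j))) (residue-≤ z (ℕ.m≤n+m j k))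
    where
    divisible : ∀ j → + (p ^ k) ℤ.∣ residue z (k ℕ.+ j)
    divisible j = subst (+ (p ^ k) ℤ.∣_) (ℤ.+-identityʳ _) (_≡_[ℤ/_].n∣a-b
      (mod-trans (residue-≤ z (ℕ.m≤m+n k j)) z≡0))
    quotient : ℕ → ℤ
    quotient j = ℤ.quotient (divisible j)
    factor : ∀ j → residue z (k ℕ.+ j) ≡ quotient j ℤ.* + (p ^ k)
    factor j = ℤ._∣_.equality (divisible j)
    factorˡ : ∀ j → residue z (k ℕ.+ j) ≡ + (p ^ k) ℤ.* quotient j
    factorˡ j = trans (factor j) (ℤ.*-comm (quotient j) _)
    quotient-compatible : ∀ j → quotient (suc j) ≡ quotient j [ℤ/ p ^ j ]
    quotient-compatible j = mod-*-cancelˡ (p ^ k) {{p^≢0 k}} _ _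
      (subst (+ (p ^ k) ℤ.* quotient (suc j) ≡ + (p ^ k) ℤ.* quotient j [ℤ/_])
        (ℕ.^-distribˡ-+-* p k j)
        (subst₂ (_≡_[ℤ/ p ^ (k ℕ.+ j) ]) (factorˡ (suc j)) (factorˡ j)
          (residue-≤ z (ℕ.+-monoʳ-≤ k (ℕ.n≤1+n j)))))

  %p≡0 : ∀ x → x ∈ pℤₚ → x %p ≡ 0
  -- The partial sum of length one is `x %p * 1`; it and 0 both lie below `p ^ 1` and are congruent
  -- modulo it.
  %p≡0 x (q , e) = trans (sym (ℕ.*-identityʳ (x %p)))
    (mod-< (partialSum-< (digit x) 1) (ℕ.m^n>0 p 1)
      (mod-trans (at (fromDigits-digit x) 1) (mod-trans (mod-sym (at e 1))
        (subst (λ n → residue q 1 ℤ.* + p ≡ + 0 [ℤ/ n ]) (sym (ℕ.*-identityʳ p))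
          (multiple-mod (residue q 1))))))

  ∣⇒∃ : ∀ {x y} → x ∣ y → ∃ λ q → q * x ≈ y
  ∣⇒∃ (q , e) = q , e

  minus-%p : ∀ x → x ∈ pℤₚ → ∀ a → a ℤ.- + (x %p) ≡ a
  minus-%p x x∈pℤₚ a = trans (cong (λ d → a ℤ.- + d) (%p≡0 x x∈pℤₚ)) (ℤ.+-identityʳ a)

  -- Cancelling `a` and then `p` lowers the modulus from `p ^ suc k` to `p ^ k`, and compatibility
  -- passes between the residues of `z` and `w` at these two levels. It serves both for the points r
  -- + p z and for the values p (g z).
  affine-level : ∀ a k x y z w →
    (residue x (suc k) ≡ a ℤ.+ + p ℤ.* residue z (suc k) [ℤ/ p ^ suc k ]) →
    (residue y (suc k) ≡ a ℤ.+ + p ℤ.* residue w (suc k) [ℤ/ p ^ suc k ]) →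
    x ≡ y [level suc k ] ⇔ z ≡ w [level k ]
  affine-level a k x y z w x≡ y≡ = mk⇔
    (λ x≡y → mod-trans (mod-sym (compatible z k)) (mod-trans
      (mod-*-cancelˡ p _ _ (mod-+-cancelˡ a (+ p ℤ.* residue z (suc k))
        (+ p ℤ.* residue w (suc k)) (mod-trans (mod-sym x≡) (mod-trans x≡y y≡))))
      (compatible w k)))
    (λ z≡w → mod-trans x≡ (mod-trans
      (mod-+-cong (mod-reflexive {a = a} refl) (mod-*-scaleˡ p _ _
        (mod-trans (compatible z k) (mod-trans z≡w (mod-sym (compatible w k))))))
      (mod-sym y≡)))

  -- Roots of isometries

  -- Distance is measured by the powers of `p` dividing the difference. That `g` respects `_≈_` is
  -- not assumed: it follows from the forward direction at all k.
  Isometry : (ℤₚ → ℤₚ) → Set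
  Isometry g = ∀ k x y → x ≡ y [level k ] ⇔ g x ≡ g y [level k ]

  isometry-root : ∀ {g} → Isometry g → ∃ λ x → g x ≈ 0#
  isometry-root {g} iso = x , mk≈ λ k →
    -- By construction `x` and the k-th approximation have the same residue at level k, so their
    -- images agree there.
    mod-trans (to (iso k x (fromℤ (approximation k))) (mod-reflexive refl))
      (approximation-root k)
    where
    reduce : ∀ k → ℤₚ → Fin (p ^ k)
    reduce k y = let instance _ = p^≢0 k in fromℕ< (ℤ.n%ℕd<d (residue y k) (p ^ k))

    reduce-injective : ∀ k y z → reduce k y ≡ reduce k z → y ≡ z [level k ]
    reduce-injective k y z e = let instance _ = p^≢0 k in
      mod-trans (mod-sym (%ℕ-mod (residue y k))) (mod-trans
        (mod-reflexive (cong +_ (fromℕ<-injective _ _ _ _ e)))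
        (%ℕ-mod (residue z k)))

    induced : ∀ k → Fin (p ^ k) → Fin (p ^ k)
    induced k t = reduce k (g (fromℕ (toℕ t)))

    induced-injective : ∀ k → Injective _≡_ _≡_ (induced k)
    induced-injective k {s} {t} e = toℕ-injective (mod-< (toℕ<n s) (toℕ<n t)
      (from (iso k (fromℕ (toℕ s)) (fromℕ (toℕ t)))
        (reduce-injective k (g (fromℕ (toℕ s))) (g (fromℕ (toℕ t))) e)))

    preimage-of-0 : ∀ k → ∃ λ t → induced k t ≡ reduce k 0#
    preimage-of-0 k = injective⇒strictlySurjective (induced-injective k) (reduce k 0#)

    approximation : ℕ → ℤ
    approximation k = + toℕ (proj₁ (preimage-of-0 k))

    approximation-root : ∀ k → g (fromℤ (approximation k)) ≡ 0# [level k ]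
    approximation-root k =
      reduce-injective k (g (fromℤ (approximation k))) 0# (proj₂ (preimage-of-0 k))

    x : ℤₚ
    x = mkℤₚ approximation λ k →
      -- A root modulo `p ^ suc k` is also one modulo `p ^ k`; both images are then 0 at level k,
      -- and `from` reflects this to the approximations.
      from (iso k (fromℤ (approximation (suc k))) (fromℤ (approximation k))) (mod-trans
      (mod-sym (compatible (g (fromℤ (approximation (suc k)))) k))
      (mod-trans (mod-coarsen (ℕ.n∣m*n p) (approximation-root (suc k)))
        (mod-sym (approximation-root k))))

  -- From suitable functions to isometries

  module _ (r : Fin p) (f : Func ℤₚ-setoid ℤₚ-setoid)
           (f∈pℤₚ : ∀ {x} → x ∈ r +pℤₚ → (f ⟨$⟩ x) ∈ pℤₚ)
           (suitable : Suitable r f) where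

    -- The values lie in `pℤₚ`, so the digits subtracted in `Suitable` are 0.
    suitable-level : ∀ k {m n} → m ∈ r +pℤₚ → n ∈ r +pℤₚ →
      m ≡ n [level k ] ⇔ (f ⟨$⟩ m) ≡ (f ⟨$⟩ n) [level k ]
    suitable-level k {m} {n} m∈ n∈ = mk⇔
      (λ m≡n → difference-mod (subst (_≡ + 0 [ℤ/ p ^ k ]) drop-%p
        (∣⇒level k _ (to (suitable k {m} {n} m∈ n∈) (level⇒∣ k _ (mod-difference m≡n))))))
      (λ fm≡fn → difference-mod (∣⇒level k _ (from (suitable k {m} {n} m∈ n∈)
        (level⇒∣ k _ (subst (_≡ + 0 [ℤ/ p ^ k ]) (sym drop-%p) (mod-difference fm≡fn))))))
      where
      drop-%p :
        (residue (f ⟨$⟩ m) k ℤ.- + ((f ⟨$⟩ m) %p)) ℤ.-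
        (residue (f ⟨$⟩ n) k ℤ.- + ((f ⟨$⟩ n) %p))
        ≡ residue (f ⟨$⟩ m) k ℤ.- residue (f ⟨$⟩ n) k
      drop-%p = cong₂ ℤ._-_
        (minus-%p (f ⟨$⟩ m) (f∈pℤₚ {m} m∈) (residue (f ⟨$⟩ m) k))
        (minus-%p (f ⟨$⟩ n) (f∈pℤₚ {n} n∈) (residue (f ⟨$⟩ n) k))

    point : ℤₚ → ℤₚ
    point z = fromℕ (toℕ r) + fromℕ p * z

    point∈ : ∀ z → point z ∈ r +pℤₚ
    point∈ z = z , ≈-refl

    -- The function g with f (r + p z) = p (g z), taken from the divisibility witness.
    cofactor : ℤₚ → ℤₚ
    cofactor z = proj₁ (∣⇒∃ (f∈pℤₚ {point z} (point∈ z)))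

    -- The summand `+ 0` gives the value the shape required by `affine-level`.
    f-point : ∀ z k →
      residue (f ⟨$⟩ point z) k ≡ + 0 ℤ.+ + p ℤ.* residue (cofactor z) k [ℤ/ p ^ k ]
    f-point z k = mod-trans (mod-sym (at (proj₂ (∣⇒∃ (f∈pℤₚ {point z} (point∈ z)))) k))
      (mod-reflexive (trans (ℤ.*-comm (residue (cofactor z) k) (+ p))
        (sym (ℤ.+-identityˡ (+ p ℤ.* residue (cofactor z) k)))))

    cofactor-isometry : Isometry cofactor
    cofactor-isometry k z w = mk⇔
      -- Up to level k + 1 for the points, across `f` at that level, and back down to level k for
      -- the cofactors.
      (λ e → to values (to images (from points e)))
      (λ e → to points (from images (from values e)))
      where
      points = affine-level (+ toℕ r) k (point z) (point w) z w
        (mod-reflexive refl) (mod-reflexive refl)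
      images = suitable-level (suc k) {point z} {point w} (point∈ z) (point∈ w)
      values = affine-level (+ 0) k (f ⟨$⟩ point z) (f ⟨$⟩ point w) (cofactor z) (cofactor w)
        (f-point z (suc k)) (f-point w (suc k))

    root-point : ∀ z → cofactor z ≈ 0# → (f ⟨$⟩ point z) ≈ 0#
    root-point z gz≈0 = mk≈ λ k → mod-trans (f-point z k)
      (subst (+ 0 ℤ.+ + p ℤ.* residue (cofactor z) k ≡_[ℤ/ p ^ k ])
        (trans (ℤ.+-identityˡ (+ p ℤ.* + 0)) (ℤ.*-zeroʳ (+ p)))
        (mod-+-cong (mod-reflexive {a = + 0} refl)
          (mod-*-cong (mod-reflexive {a = + p} refl) (at gz≈0 k))))

    root-unique : ∀ {x y} → x ∈ r +pℤₚ → (f ⟨$⟩ x) ≈ 0# → y ∈ r +pℤₚ → (f ⟨$⟩ y) ≈ 0# →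
      x ≈ y
    root-unique {x} {y} x∈ fx≈0 y∈ fy≈0 = mk≈ λ k →
      -- Two roots have congruent values at every level, and suitability reflects this to the roots.
      from (suitable-level k {x} {y} x∈ y∈) (mod-trans (at fx≈0 k) (mod-sym (at fy≈0 k)))

    unique-root : ∃! _≈_ λ x → x ∈ r +pℤₚ × (f ⟨$⟩ x) ≈ 0#
    unique-root =
      let z , gz≈0 = isometry-root {cofactor} cofactor-isometry in
      point z , (point∈ z , root-point z gz≈0) , λ {y} (y∈ , fy≈0) →
        root-unique {point z} {y} (point∈ z) (root-point z gz≈0) y∈ fy≈0

theorem5p2 : (p : ℕ) .{{_ : NonTrivial p}} → let open Padic p in
    (r : Fin p) (f : Func ℤₚ-setoid ℤₚ-setoid) →
    (∀ {x} → x ∈ r +pℤₚ → (f ⟨$⟩ x) ∈ pℤₚ) →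
    Suitable r f →
    ∃! _≈_ λ x → x ∈ r +pℤₚ × (f ⟨$⟩ x) ≈ 0#
theorem5p2 p r f f∈pℤₚ suitable = unique-root p r f (λ {x} → f∈pℤₚ {x}) suitable
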